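{- Let $a_n$ be the number of pop-stacked permutations of $[n]=\{1,\dots,n\}$ and let $F(x)=\sum_{n\ge 0}a_nx^n\in\mathbb{Q}[[x]]$. If $F(x)=p(x)/q(x)$ with $p(x),q(x)\in\mathbb{Q}[x]$ and $q\neq 0$, then $\deg p\ge 500$ or $\deg q\ge 500$.
   Context: For a permutation $\pi=a_1a_2\cdots a_n$ of $[n]$, a descending run of $\pi$ is a maximal sequence of consecutive letters $a_i>a_{i+1}>\cdots>a_{i+j}$. Factor $\pi$ into its descending runs, $\pi=D_1D_2\cdots D_m$; the pop-stack operator $P$ reverses each run: $P(\pi)=D_1^rD_2^r\cdots D_m^r$, where $D^r$ is the reversal of the word $D$. A permutation $\sigma$ of $[n]$ is pop-stacked if $\sigma=P(\pi)$ for some permutation $\pi$ of $[n]$. The empty permutation is counted as pop-stacked, so $a_0=1$. -}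

module Defs where

open import Data.Empty using (⊥)
open import Data.Fin.Base using (toℕ)
open import Data.Integer.Base using (+_)
open import Data.List.Base
  using (List; []; _∷_; _++_; map; concat; concatMap; filter; length; reverse; applyUpTo)
open import Data.List.Membership.Propositional using (_∈_; find; lose)
open import Data.List.Membership.Propositional.Properties
  using (∈-map⁺; ∈-map⁻; ∈-++⁺ˡ; ∈-++⁺ʳ; ∈-++⁻; ∈-∃++; ∈-filter⁺; ∈-filter⁻)
open import Data.List.Properties using (≡-dec; ∷-injectiveʳ; filter-all; filter-reject; filter-accept)
open import Data.List.Relation.Binary.Permutation.Propositional
  using (_↭_; ↭-refl; ↭-sym; ↭-trans; prep; swap)
open import Data.List.Relation.Binary.Permutation.Propositional.Properties
  using (All-resp-↭; ∈-resp-↭; ↭-empty-inv; drop-mid)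
open import Data.List.Relation.Unary.All as All using (All; []; _∷_)
open import Data.List.Relation.Unary.AllPairs using ([]; _∷_)
open import Data.List.Relation.Unary.Any using (here; there; any?)
open import Data.List.Relation.Unary.Unique.Propositional using (Unique)
open import Data.List.Relation.Unary.Unique.Propositional.Properties
  using (applyUpTo⁺₁; ++⁺; map⁺; filter⁺)
open import Data.Nat.Base using (ℕ; zero; suc; _∸_; _>_)
open import Data.Nat.Properties using (_≟_; _<?_; <⇒≢; suc-injective)
open import Data.Product.Base using (∃-syntax; _×_; _,_)
open import Data.Rational.Base using (ℚ; 0ℚ; _*_; _/_)
open import Data.Rational.Properties using (+-0-commutativeMonoid)
open import Data.Sum.Base using (inj₁; inj₂)
open import Function.Base using (_∘_)
open import Function.Bundles using (_⇔_; mk⇔)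
open import Relation.Binary.PropositionalEquality
  using (_≡_; _≢_; refl; sym; trans; cong)
open import Relation.Nullary.Decidable using (Dec; yes; no; ¬?; map′)
open import Algebra.Properties.CommutativeMonoid.Sum +-0-commutativeMonoid using (sum⁺-syntax)

[1⋯_] : ℕ → List ℕ
[1⋯ n ] = applyUpTo suc n

IsPermutationOf[1⋯_] : ℕ → List ℕ → Set
IsPermutationOf[1⋯ n ] π = π ↭ [1⋯ n ]

-- Put a letter in front of a word already factored into descending runs: it
-- joins the first run if it exceeds that run's first letter, and otherwise
-- forms a run of its own.
consRun : ℕ → List (List ℕ) → List (List ℕ)
consRun x []              = (x ∷ []) ∷ []
consRun x ([] ∷ Ds)       = (x ∷ []) ∷ Ds  -- not reached: runs are nonempty
consRun x ((y ∷ D) ∷ Ds) with y <? x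
... | yes _ = (x ∷ y ∷ D) ∷ Ds
... | no  _ = (x ∷ []) ∷ (y ∷ D) ∷ Ds

descendingRuns : List ℕ → List (List ℕ)
descendingRuns []       = []
descendingRuns (x ∷ xs) = consRun x (descendingRuns xs)

P : List ℕ → List ℕ
P π = concat (map reverse (descendingRuns π))

IsPopStacked : ℕ → List ℕ → Set
IsPopStacked n σ = ∃[ π ] IsPermutationOf[1⋯ n ] π × σ ≡ P π

insertions : ℕ → List ℕ → List (List ℕ)
insertions x []       = (x ∷ []) ∷ []
insertions x (y ∷ ys) = (x ∷ y ∷ ys) ∷ map (y ∷_) (insertions x ys)

permutations : List ℕ → List (List ℕ)
permutations []       = [] ∷ []
permutations (x ∷ xs) = concatMap (insertions x) (permutations xs)

private
  insertions-sound : ∀ x ys {zs} → zs ∈ insertions x ys → zs ↭ x ∷ ys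
  insertions-sound x []       (here refl) = ↭-refl
  insertions-sound x (y ∷ ys) (here refl) = ↭-refl
  insertions-sound x (y ∷ ys) (there zs∈)
    with _ , ws∈ , refl ← ∈-map⁻ (y ∷_) zs∈ =
    ↭-trans (prep y (insertions-sound x ys ws∈)) (swap y x ↭-refl)

  insertions-complete : ∀ x as bs → as ++ x ∷ bs ∈ insertions x (as ++ bs)
  insertions-complete x []       []       = here refl
  insertions-complete x []       (b ∷ bs) = here refl
  insertions-complete x (a ∷ as) bs       =
    there (∈-map⁺ (a ∷_) (insertions-complete x as bs))

  concatMap⁻ : ∀ x yss {zs} → zs ∈ concatMap (insertions x) yss →
               ∃[ ys ] ys ∈ yss × zs ∈ insertions x ys
  concatMap⁻ x (ys ∷ yss) zs∈ with ∈-++⁻ (insertions x ys) zs∈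
  ... | inj₁ p = ys , here refl , p
  ... | inj₂ p with ys′ , q , r ← concatMap⁻ x yss p = ys′ , there q , r

  concatMap⁺ : ∀ x {ys yss zs} → ys ∈ yss → zs ∈ insertions x ys →
               zs ∈ concatMap (insertions x) yss
  concatMap⁺ x             (here refl) p = ∈-++⁺ˡ p
  concatMap⁺ x {yss = ws ∷ _} (there q) p = ∈-++⁺ʳ (insertions x ws) (concatMap⁺ x q p)

  delete : ℕ → List ℕ → List ℕ
  delete x = filter (λ y → ¬? (x ≟ y))

  delete-insertion : ∀ x ys {zs} → All (x ≢_) ys → zs ∈ insertions x ys → delete x zs ≡ ys
  delete-insertion x [] _ (here refl) = filter-reject (λ y → ¬? (x ≟ y)) (λ f → f refl)
  delete-insertion x (y ∷ ys) x∉ (here refl) =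
    trans (filter-reject (λ y → ¬? (x ≟ y)) (λ f → f refl)) (filter-all (λ y → ¬? (x ≟ y)) x∉)
  delete-insertion x (y ∷ ys) (x≢y ∷ x∉) (there zs∈)
    with _ , ws∈ , refl ← ∈-map⁻ (y ∷_) zs∈ =
    trans (filter-accept (λ y → ¬? (x ≟ y)) x≢y) (cong (y ∷_) (delete-insertion x ys x∉ ws∈))

  insertions-unique : ∀ x ys → All (x ≢_) ys → Unique (insertions x ys)
  insertions-unique x []       _          = [] ∷ []
  insertions-unique x (y ∷ ys) (x≢y ∷ x∉) =
    All.tabulate (λ zs∈ eq → head≢ zs∈ (sym eq)) ∷ map⁺ ∷-injectiveʳ (insertions-unique x ys x∉)
    where
    head≢ : ∀ {zs} → zs ∈ map (y ∷_) (insertions x ys) → zs ≢ x ∷ y ∷ ys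
    head≢ zs∈ eq with _ , _ , refl ← ∈-map⁻ (y ∷_) zs∈ | refl ← eq = x≢y refl

  concatMap-unique : ∀ x yss → All (All (x ≢_)) yss → Unique yss →
                     Unique (concatMap (insertions x) yss)
  concatMap-unique x []         _          _          = []
  concatMap-unique x (ys ∷ yss) (x∉ ∷ x∉s) (ys∉ ∷ u) =
    ++⁺ (insertions-unique x ys x∉) (concatMap-unique x yss x∉s u) disjoint
    where
    disjoint : ∀ {v} → v ∈ insertions x ys × v ∈ concatMap (insertions x) yss → ⊥
    disjoint (p , q) with ys′ , r , s ← concatMap⁻ x yss q =
      All.lookup ys∉ r
        (trans (sym (delete-insertion x ys x∉ p)) (delete-insertion x ys′ (All.lookup x∉s r) s))

permutations-sound : ∀ xs {zs} → zs ∈ permutations xs → zs ↭ xs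
permutations-sound []       (here refl) = ↭-refl
permutations-sound (x ∷ xs) zs∈ with ys , p , q ← concatMap⁻ x (permutations xs) zs∈ =
  ↭-trans (insertions-sound x ys q) (prep x (permutations-sound xs p))

permutations-complete : ∀ xs {zs} → zs ↭ xs → zs ∈ permutations xs
permutations-complete []       p with refl ← ↭-empty-inv p = here refl
permutations-complete (x ∷ xs) p
  with as , bs , refl ← ∈-∃++ (∈-resp-↭ (↭-sym p) (here refl)) =
  concatMap⁺ x (permutations-complete xs (drop-mid as [] p)) (insertions-complete x as bs)

permutations-unique : ∀ xs → Unique xs → Unique (permutations xs)
permutations-unique []       _         = [] ∷ []
permutations-unique (x ∷ xs) (x∉ ∷ u) =
  concatMap-unique x (permutations xs)
    (All.tabulate (λ p → All-resp-↭ (↭-sym (permutations-sound xs p)) x∉))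
    (permutations-unique xs u)

isPopStacked? : ∀ n σ → Dec (IsPopStacked n σ)
isPopStacked? n σ = map′ to from (any? (λ π → ≡-dec _≟_ σ (P π)) (permutations [1⋯ n ]))
  where
  to : _ → IsPopStacked n σ
  to h with π , π∈ , eq ← find h = π , permutations-sound [1⋯ n ] π∈ , eq

  from : IsPopStacked n σ → _
  from (π , p , eq) = lose (permutations-complete [1⋯ n ] p) eq

popStackedPermutations : ℕ → List (List ℕ)
popStackedPermutations n = filter (isPopStacked? n) (permutations [1⋯ n ])

a : ℕ → ℕ
a n = length (popStackedPermutations n)

-- The two facts that make a n the number of pop-stacked permutations of [n].

∈-popStackedPermutations : ∀ n {σ} →
  σ ∈ popStackedPermutations n ⇔ (IsPermutationOf[1⋯ n ] σ × IsPopStacked n σ)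
∈-popStackedPermutations n = mk⇔
  (λ σ∈ → let (p , q) = ∈-filter⁻ (isPopStacked? n) {xs = permutations [1⋯ n ]} σ∈
          in permutations-sound [1⋯ n ] p , q)
  (λ (p , q) → ∈-filter⁺ (isPopStacked? n) (permutations-complete [1⋯ n ] p) q)

popStackedPermutations-unique : ∀ n → Unique (popStackedPermutations n)
popStackedPermutations-unique n =
  filter⁺ (isPopStacked? n)
    (permutations-unique [1⋯ n ] (applyUpTo⁺₁ suc n (λ i<j _ → <⇒≢ i<j ∘ suc-injective)))

-- ℚ[[x]]: a series is its sequence of coefficients.
PowerSeries : Set
PowerSeries = ℕ → ℚ

infixl 7 _⊛_
_⊛_ : PowerSeries → PowerSeries → PowerSeries
(f ⊛ g) n = ∑[ i ≤ n ] (f (toℕ i) * g (n ∸ toℕ i))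

F : PowerSeries
F n = + a n / 1

-- ℚ[x]: coefficients listed from the constant term upwards. Trailing zeros are
-- allowed, so the zero polynomial and the degree are read off from coeff.
Polynomial : Set
Polynomial = List ℚ

coeff : Polynomial → PowerSeries
coeff []      _       = 0ℚ
coeff (c ∷ p) zero    = c
coeff (c ∷ p) (suc n) = coeff p n

IsZero : Polynomial → Set
IsZero p = ∀ n → coeff p n ≡ 0ℚ

-- The zero polynomial has no degree in ℕ.
HasDegree : Polynomial → ℕ → Set
HasDegree p d = coeff p d ≢ 0ℚ × (∀ n → n > d → coeff p n ≡ 0ℚ)

-- f = p / q, for q nonzero. As q may have zero constant term, the quotient is
-- taken in the fraction field of ℚ[[x]], where the equation means q f = p.
_IsQuotient_/_ : PowerSeries → Polynomial → Polynomial → Set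
f IsQuotient p / q = ∀ n → (coeff q ⊛ f) n ≡ coeff p n

{-# OPTIONS --safe #-}

-- Pop-stacked permutations are too numerous for F to be rational, whatever the
-- degrees. A permutation is recovered from its image under P together with the
-- lengths of its descending runs, and these lengths form one of at most 2 ^ n
-- compositions, so n ! ≤ a n * 2 ^ n. On the other hand, comparing coefficients
-- in q F = p at the lowest nonzero coefficient of q bounds a n, for large n, by
-- a constant multiple of a 0 + ⋯ + a (n - 1), so that a n grows at most
-- exponentially.

module Submission where

open import Defs
open import Algebra.Properties.Group using (inverseˡ-unique)
open import Data.Empty using (⊥-elim)
open import Data.Integer.Base as ℤ using (+_)
import Data.Integer.Properties as ℤₚ
open import Data.List.Base
  using (List; []; _∷_; _++_; map; concat; concatMap; length; reverse; cartesianProduct)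
open import Data.List.Membership.Propositional using (_∈_)
open import Data.List.Membership.Propositional.Properties
  using (∈-map⁺; ∈-map⁻; ∈-++⁺ˡ; ∈-++⁺ʳ; ∈-++⁻; ∈-∃++; ∈-cartesianProduct⁺)
open import Data.List.Properties
  using (length-++; length-map; length-reverse; length-applyUpTo;
         reverse-injective; ∷-injective; ∷-injectiveˡ; ∷-injectiveʳ)
open import Data.List.Relation.Binary.Permutation.Propositional using (_↭_; ↭-refl; ↭-trans; ↭-reflexive)
open import Data.List.Relation.Binary.Permutation.Propositional.Properties
  using (↭-length; ↭-reverse; ++⁺)
open import Data.List.Relation.Binary.Subset.Propositional using (_⊆_)
open import Data.List.Relation.Unary.All as All using (All; []; _∷_)
open import Data.List.Relation.Unary.AllPairs using ([]; _∷_)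
open import Data.List.Relation.Unary.Any using (here; there)
open import Data.List.Relation.Unary.Unique.Propositional using (Unique)
open import Data.List.Relation.Unary.Unique.Propositional.Properties using (applyUpTo⁺₁; map⁺)
open import Data.Nat.Base
open import Data.Nat.Coprimality as Coprime using (Coprime; 1-coprimeTo)
open import Data.Nat.Properties
open import Data.Nat.Tactic.RingSolver using (solve-∀)
open import Data.Product.Base using (∃-syntax; _×_; _,_)
open import Data.Rational.Base as ℚ using (ℚ; mkℚ; 0ℚ; *≤*)
import Data.Rational.Properties as ℚₚ
open import Data.Rational.Unnormalised.Base using (mkℚᵘ; *≡*)
open import Data.Sum.Base using (_⊎_; inj₁; inj₂)
open import Function.Base using (_∘_)
open import Function.Bundles using (Equivalence)
open import Relation.Binary.PropositionalEquality
open import Relation.Nullary.Decidable using (yes; no)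
open import Relation.Nullary.Negation using (¬_)

-- Lists

++-injective : ∀ {A : Set} (xs zs : List A) {ys ws} → length xs ≡ length zs →
               xs ++ ys ≡ zs ++ ws → xs ≡ zs × ys ≡ ws
++-injective []       []       _ eq = refl , eq
++-injective (x ∷ xs) (z ∷ zs) l eq
  with refl ← ∷-injectiveˡ eq
  with refl , ys≡ws ← ++-injective xs zs (suc-injective l) (∷-injectiveʳ eq) = refl , ys≡ws

-- Deleting one occurrence of the head `x` from `ys` leaves a list that still contains the tail,
-- because `x` does not recur in the tail.
Unique⇒length≤ : ∀ {A : Set} {xs ys : List A} → Unique xs → xs ⊆ ys → length xs ≤ length ys
Unique⇒length≤ {xs = []}     _           _   = z≤n
Unique⇒length≤ {xs = x ∷ xs} (x∉xs ∷ xs!) xs⊆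
  with as , bs , refl ← ∈-∃++ (xs⊆ (here refl)) = begin
  suc (length xs)               ≤⟨ s≤s (Unique⇒length≤ xs! remaining) ⟩
  suc (length (as ++ bs))       ≡⟨ cong suc (length-++ as) ⟩
  suc (length as + length bs)   ≡⟨ +-suc (length as) (length bs) ⟨
  length as + suc (length bs)   ≡⟨ length-++ as ⟨
  length (as ++ x ∷ bs)         ∎
  where
  open ≤-Reasoning
  remaining : xs ⊆ as ++ bs
  remaining y∈ with ∈-++⁻ as (xs⊆ (there y∈))
  ... | inj₁ y∈as         = ∈-++⁺ˡ y∈as
  ... | inj₂ (there y∈bs) = ∈-++⁺ʳ as y∈bs
  ... | inj₂ (here refl)  = ⊥-elim (All.lookup x∉xs y∈ refl)

length-insertions : ∀ x ys → length (insertions x ys) ≡ suc (length ys)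
length-insertions x []       = refl
length-insertions x (y ∷ ys) =
  cong suc (trans (length-map (y ∷_) (insertions x ys)) (length-insertions x ys))

length-concatMap-insertions : ∀ x m yss → All (λ ys → length ys ≡ m) yss →
                              length (concatMap (insertions x) yss) ≡ length yss * suc m
length-concatMap-insertions x m []         []         = refl
length-concatMap-insertions x m (ys ∷ yss) (refl ∷ h) = trans
  (length-++ (insertions x ys))
  (cong₂ _+_ (length-insertions x ys) (length-concatMap-insertions x m yss h))

length-permutations : ∀ xs → length (permutations xs) ≡ length xs !
length-permutations []       = refl
length-permutations (x ∷ xs) = begin
  length (concatMap (insertions x) (permutations xs))
    ≡⟨ length-concatMap-insertions x (length xs) (permutations xs)
         (All.tabulate (↭-length ∘ permutations-sound xs)) ⟩
  length (permutations xs) * suc (length xs) ≡⟨ *-comm (length (permutations xs)) _ ⟩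
  suc (length xs) * length (permutations xs) ≡⟨ cong (suc (length xs) *_) (length-permutations xs) ⟩
  suc (length xs) * length xs !              ∎
  where open ≡-Reasoning

-- Run lengths

runLengths : List ℕ → List ℕ
runLengths π = map length (descendingRuns π)

growFirst : List ℕ → List ℕ
growFirst []       = []
growFirst (k ∷ ks) = suc k ∷ ks

-- Either a new part 1 is put in front or the first part grows by one. As `growFirst [] ≡ []`, the
-- list also holds words that are not compositions of `n`; this keeps its length at exactly `2 ^ n`.
compositions : ℕ → List (List ℕ)
compositions zero    = [] ∷ []
compositions (suc n) = map (1 ∷_) (compositions n) ++ map growFirst (compositions n)

length-compositions : ∀ n → length (compositions n) ≡ 2 ^ n
length-compositions zero    = refl
length-compositions (suc n) = begin
  length (map (1 ∷_) (compositions n) ++ map growFirst (compositions n))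
    ≡⟨ length-++ (map (1 ∷_) (compositions n)) ⟩
  length (map (1 ∷_) (compositions n)) + length (map growFirst (compositions n))
    ≡⟨ cong₂ _+_ (length-map (1 ∷_) (compositions n)) (length-map growFirst (compositions n)) ⟩
  length (compositions n) + length (compositions n)
    ≡⟨ cong (λ l → l + l) (length-compositions n) ⟩
  2 ^ n + 2 ^ n         ≡⟨ cong (_+_ (2 ^ n)) (+-identityʳ (2 ^ n)) ⟨
  2 ^ n + (2 ^ n + 0)   ∎
  where open ≡-Reasoning

-- The alternatives follow the clauses of `consRun`; the last stands for an empty first run, which
-- `[]∉descendingRuns` excludes.
lengths-consRun : ∀ x Ds → map length (consRun x Ds) ≡ 1 ∷ map length Ds ⊎
                           map length (consRun x Ds) ≡ growFirst (map length Ds) ⊎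
                           [] ∈ Ds
lengths-consRun x []             = inj₁ refl
lengths-consRun x ([] ∷ Ds)      = inj₂ (inj₂ (here refl))
lengths-consRun x ((y ∷ D) ∷ Ds) with y <? x
... | yes _ = inj₂ (inj₁ refl)
... | no  _ = inj₁ refl

[]∉consRun : ∀ x Ds → ¬ [] ∈ Ds → ¬ [] ∈ consRun x Ds
[]∉consRun x []             []∉ (here ())
[]∉consRun x ([] ∷ Ds)      []∉ _ = []∉ (here refl)
[]∉consRun x ((y ∷ D) ∷ Ds) []∉ p with y <? x | p
... | yes _ | there q = []∉ (there q)
... | no  _ | there q = []∉ q

[]∉descendingRuns : ∀ π → ¬ [] ∈ descendingRuns π
[]∉descendingRuns (x ∷ π) = []∉consRun x (descendingRuns π) ([]∉descendingRuns π)

runLengths∈compositions : ∀ π → runLengths π ∈ compositions (length π)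
runLengths∈compositions []      = here refl
runLengths∈compositions (x ∷ π) with lengths-consRun x (descendingRuns π)
... | inj₁ eq rewrite eq        =
  ∈-++⁺ˡ (∈-map⁺ (1 ∷_) (runLengths∈compositions π))
... | inj₂ (inj₁ eq) rewrite eq =
  ∈-++⁺ʳ (map (1 ∷_) (compositions (length π))) (∈-map⁺ growFirst (runLengths∈compositions π))
... | inj₂ (inj₂ []∈)           = ⊥-elim ([]∉descendingRuns π []∈)

-- Recovering a permutation from its image and run lengths

concat-consRun : ∀ x Ds → concat (consRun x Ds) ≡ x ∷ concat Ds
concat-consRun x []             = refl
concat-consRun x ([] ∷ Ds)      = refl
concat-consRun x ((y ∷ D) ∷ Ds) with y <? x
... | yes _ = refl
... | no  _ = refl

concat-descendingRuns : ∀ π → concat (descendingRuns π) ≡ π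
concat-descendingRuns []      = refl
concat-descendingRuns (x ∷ π) =
  trans (concat-consRun x (descendingRuns π)) (cong (x ∷_) (concat-descendingRuns π))

-- The lengths mark where each block of the common concatenation ends, so the blocks agree one by
-- one and each reversal can be undone.
concat-map-reverse-injective : ∀ {A : Set} (Ds Es : List (List A)) →
  map length Ds ≡ map length Es →
  concat (map reverse Ds) ≡ concat (map reverse Es) → Ds ≡ Es
concat-map-reverse-injective []       []       _ _  = refl
concat-map-reverse-injective (D ∷ Ds) (E ∷ Es) l eq
  with |D|≡|E| , ls ← ∷-injective l
  with rD≡rE , eqs ← ++-injective (reverse D) (reverse E)
         (trans (length-reverse D) (trans |D|≡|E| (sym (length-reverse E)))) eq =
  cong₂ _∷_ (reverse-injective rD≡rE) (concat-map-reverse-injective Ds Es ls eqs)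

image-and-runLengths : List ℕ → List ℕ × List ℕ
image-and-runLengths π = P π , runLengths π

image-and-runLengths-injective : ∀ {π ρ} → image-and-runLengths π ≡ image-and-runLengths ρ → π ≡ ρ
image-and-runLengths-injective {π} {ρ} eq = begin
  π                         ≡⟨ concat-descendingRuns π ⟨
  concat (descendingRuns π) ≡⟨ cong concat (concat-map-reverse-injective _ _
                                 (cong (λ (_ , ls) → ls) eq) (cong (λ (σ , _) → σ) eq)) ⟩
  concat (descendingRuns ρ) ≡⟨ concat-descendingRuns ρ ⟩
  ρ                         ∎
  where open ≡-Reasoning

concat-map-reverse-↭ : ∀ {A : Set} (Ds : List (List A)) → concat (map reverse Ds) ↭ concat Ds
concat-map-reverse-↭ []       = ↭-refl
concat-map-reverse-↭ (D ∷ Ds) = ++⁺ (↭-reverse D) (concat-map-reverse-↭ Ds)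

P-↭ : ∀ π → P π ↭ π
P-↭ π = ↭-trans (concat-map-reverse-↭ (descendingRuns π)) (↭-reflexive (concat-descendingRuns π))

length-cartesianProduct : ∀ {A B : Set} (xs : List A) (ys : List B) →
                          length (cartesianProduct xs ys) ≡ length xs * length ys
length-cartesianProduct []       ys = refl
length-cartesianProduct (x ∷ xs) ys = trans
  (length-++ (map (x ,_) ys))
  (cong₂ _+_ (length-map (x ,_) ys) (length-cartesianProduct xs ys))

-- Pigeonhole: `image-and-runLengths` sends the `n !` permutations injectively into pairs of a
-- pop-stacked permutation and a member of `compositions n`.
n!≤aₙ*2^n : ∀ n → n ! ≤ a n * 2 ^ n
n!≤aₙ*2^n n = begin
  n !                                                    ≡⟨ cong _! (length-applyUpTo suc n) ⟨
  length [1⋯ n ] !                                       ≡⟨ length-permutations [1⋯ n ] ⟨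
  length (permutations [1⋯ n ])                          ≡⟨ length-map image-and-runLengths (permutations [1⋯ n ]) ⟨
  length (map image-and-runLengths (permutations [1⋯ n ]))
    ≤⟨ Unique⇒length≤ (map⁺ image-and-runLengths-injective (permutations-unique [1⋯ n ] [1⋯n]!)) images⊆ ⟩
  length (cartesianProduct (popStackedPermutations n) (compositions n))
    ≡⟨ length-cartesianProduct (popStackedPermutations n) (compositions n) ⟩
  a n * length (compositions n)                          ≡⟨ cong (a n *_) (length-compositions n) ⟩
  a n * 2 ^ n                                            ∎
  where
  open ≤-Reasoning
  [1⋯n]! : Unique [1⋯ n ]
  [1⋯n]! = applyUpTo⁺₁ suc n (λ i<j _ → <⇒≢ i<j ∘ suc-injective)

  images⊆ : map image-and-runLengths (permutations [1⋯ n ]) ⊆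
            cartesianProduct (popStackedPermutations n) (compositions n)
  images⊆ v∈ with π , π∈ , refl ← ∈-map⁻ image-and-runLengths v∈ = ∈-cartesianProduct⁺
    (Equivalence.from (∈-popStackedPermutations n) (↭-trans (P-↭ π) π↭ , π , π↭ , refl))
    (subst (λ m → runLengths π ∈ compositions m)
      (trans (↭-length π↭) (length-applyUpTo suc n)) (runLengths∈compositions π))
    where
    π↭ : π ↭ [1⋯ n ]
    π↭ = permutations-sound [1⋯ n ] π∈

-- Factorials outgrow exponentials

-- The last `t` factors of the factorial, `d + 1` up to `d + t`, all exceed `d`.
d^t≤[d+t]! : ∀ d t → d ^ t ≤ (d + t) !
d^t≤[d+t]! d zero    = 1≤n! (d + 0)
d^t≤[d+t]! d (suc t) rewrite +-suc d t =
  *-mono-≤ (m≤n⇒m≤1+n (m≤m+n d t)) (d^t≤[d+t]! d t)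

n<2^n : ∀ n → n < 2 ^ n
n<2^n zero    = s≤s z≤n
n<2^n (suc n) = begin-strict
  suc n               <⟨ s≤s (n<2^n n) ⟩
  1 + 2 ^ n           ≤⟨ +-mono-≤ (m^n>0 2 n) (m≤m+n (2 ^ n) 0) ⟩
  2 ^ n + (2 ^ n + 0) ∎
  where open ≤-Reasoning

^-distribʳ-* : ∀ m n o → (m * n) ^ o ≡ m ^ o * n ^ o
^-distribʳ-* m n zero    = refl
^-distribʳ-* m n (suc o) = trans (cong (m * n *_) (^-distribʳ-* m n o)) (interchange m n (m ^ o) (n ^ o))
  where
  interchange : ∀ a b c d → a * b * (c * d) ≡ a * c * (b * d)
  interchange = solve-∀

-- The witness is d + t with d = 2 B and t = K * B ^ d, as d ^ t = 2 ^ t * B ^ t.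
factorial-superexponential : ∀ K B .{{_ : NonZero B}} → ∃[ n ] K * B ^ n < n !
factorial-superexponential K B = d + t , (begin-strict
  K * B ^ (d + t)     ≡⟨ cong (K *_) (^-distribˡ-+-* B d t) ⟩
  K * (B ^ d * B ^ t) ≡⟨ *-assoc K (B ^ d) (B ^ t) ⟨
  t * B ^ t           <⟨ *-monoˡ-< (B ^ t) {{m^n≢0 B t}} (n<2^n t) ⟩
  2 ^ t * B ^ t       ≡⟨ ^-distribʳ-* 2 B t ⟨
  d ^ t               ≤⟨ d^t≤[d+t]! d t ⟩
  (d + t) !           ∎)
  where
  open ≤-Reasoning
  d = 2 * B
  t = K * B ^ d

-- Growth of partial sums

-- The sum stops before `f n`, so that bounding `f n` by a multiple of `partialSum f n` is a
-- recursive estimate.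
partialSum : (ℕ → ℕ) → ℕ → ℕ
partialSum f zero    = 0
partialSum f (suc n) = f n + partialSum f n

-- From index `N` on, adding the next term multiplies the partial sum by at most `suc C`.
partialSum-exponential : ∀ f N C → (∀ n → f (N + n) ≤ C * partialSum f (N + n)) →
                         ∀ n → partialSum f (N + n) ≤ partialSum f N * suc C ^ n
partialSum-exponential f N C h zero    =
  ≤-reflexive (trans (cong (partialSum f) (+-identityʳ N)) (sym (*-identityʳ _)))
partialSum-exponential f N C h (suc n) rewrite +-suc N n = begin
  f (N + n) + partialSum f (N + n)             ≤⟨ +-monoˡ-≤ _ (h n) ⟩
  C * partialSum f (N + n) + partialSum f (N + n)
    ≡⟨ +-comm (C * partialSum f (N + n)) _ ⟩
  suc C * partialSum f (N + n)                 ≤⟨ *-monoʳ-≤ (suc C) (partialSum-exponential f N C h n) ⟩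
  suc C * (partialSum f N * suc C ^ n)         ≡⟨ swap-left (suc C) (partialSum f N) (suc C ^ n) ⟩
  partialSum f N * (suc C * suc C ^ n)         ∎
  where
  open ≤-Reasoning
  swap-left : ∀ x y z → x * (y * z) ≡ y * (x * z)
  swap-left = solve-∀

!-monoʳ-+ : ∀ N n → n ! ≤ (N + n) !
!-monoʳ-+ zero    n = ≤-refl
!-monoʳ-+ (suc N) n = ≤-trans (!-monoʳ-+ N n) (m≤m+n ((N + n) !) _)

a-not-bounded-by-partialSum : ∀ N C → ¬ (∀ n → a (N + n) ≤ C * partialSum a (N + n))
a-not-bounded-by-partialSum N C h =
  let n , K*Bⁿ<n! = factorial-superexponential K B in <⇒≱ K*Bⁿ<n! (n!≤K*Bⁿ n)
  where
  open ≤-Reasoning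
  -- `K` collects the factors independent of `n`. In `B`, the factor 2 comes from the `2 ^ n`
  -- compositions and `suc C` from the growth of the partial sums.
  K = C * partialSum a N * 2 ^ N
  B = 2 * suc C
  rearrange : ∀ c s x y z → c * (s * x) * (y * z) ≡ c * s * y * (z * x)
  rearrange = solve-∀

  n!≤K*Bⁿ : ∀ n → n ! ≤ K * B ^ n
  n!≤K*Bⁿ n = begin
    n !                                                     ≤⟨ !-monoʳ-+ N n ⟩
    (N + n) !                                               ≤⟨ n!≤aₙ*2^n (N + n) ⟩
    a (N + n) * 2 ^ (N + n)                                 ≤⟨ *-monoˡ-≤ (2 ^ (N + n)) (h n) ⟩
    C * partialSum a (N + n) * 2 ^ (N + n)
      ≤⟨ *-monoˡ-≤ (2 ^ (N + n)) (*-monoʳ-≤ C (partialSum-exponential a N C h n)) ⟩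
    C * (partialSum a N * suc C ^ n) * 2 ^ (N + n)
      ≡⟨ cong (C * (partialSum a N * suc C ^ n) *_) (^-distribˡ-+-* 2 N n) ⟩
    C * (partialSum a N * suc C ^ n) * (2 ^ N * 2 ^ n)
      ≡⟨ rearrange C (partialSum a N) (suc C ^ n) (2 ^ N) (2 ^ n) ⟩
    K * (2 ^ n * suc C ^ n)                                 ≡⟨ cong (K *_) (^-distribʳ-* 2 (suc C) n) ⟨
    K * B ^ n                                               ∎

-- Rational series with natural coefficients

fromℕ : ℕ → ℚ
fromℕ m = + m ℚ./ 1

coprime-1 : ∀ m → Coprime m 1
coprime-1 m = Coprime.sym (1-coprimeTo m)

-- Division by 1 normalises through a gcd that is stuck on a variable `m`; rewriting to the explicit
-- fraction lets sums, products and comparisons compute.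
fromℕ≡mkℚ : ∀ m → fromℕ m ≡ mkℚ (+ m) 0 (coprime-1 m)
fromℕ≡mkℚ m = ℚₚ.normalize-coprime (coprime-1 m)

fromℕ-homo-+ : ∀ m n → fromℕ (m + n) ≡ fromℕ m ℚ.+ fromℕ n
fromℕ-homo-+ m n rewrite fromℕ≡mkℚ m | fromℕ≡mkℚ n =
  cong (ℚ._/ 1) (sym (cong₂ ℤ._+_ (ℤₚ.*-identityʳ (+ m)) (ℤₚ.*-identityʳ (+ n))))

fromℕ-homo-* : ∀ m n → fromℕ (m * n) ≡ fromℕ m ℚ.* fromℕ n
fromℕ-homo-* m n rewrite fromℕ≡mkℚ m | fromℕ≡mkℚ n = cong (ℚ._/ 1) (ℤₚ.pos-* m n)

fromℕ-mono-≤ : ∀ {m n} → m ≤ n → fromℕ m ℚ.≤ fromℕ n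
fromℕ-mono-≤ {m} {n} m≤n rewrite fromℕ≡mkℚ m | fromℕ≡mkℚ n =
  *≤* (ℤₚ.*-monoʳ-≤-nonNeg (+ 1) (ℤ.+≤+ m≤n))

fromℕ-cancel-≤ : ∀ {m n} → fromℕ m ℚ.≤ fromℕ n → m ≤ n
fromℕ-cancel-≤ {m} {n} p rewrite fromℕ≡mkℚ m | fromℕ≡mkℚ n with *≤* q ← p =
  ℤₚ.drop‿+≤+ (ℤₚ.*-cancelʳ-≤-pos (+ m) (+ n) (+ 1) q)

0≤fromℕ : ∀ m → 0ℚ ℚ.≤ fromℕ m
0≤fromℕ m = fromℕ-mono-≤ {0} {m} z≤n

∣fromℕ∣ : ∀ m → ℚ.∣ fromℕ m ∣ ≡ fromℕ m
∣fromℕ∣ m = ℚₚ.0≤p⇒∣p∣≡p (0≤fromℕ m)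

-- A denominator is at least 1. This gives natural upper bounds for the coefficients of `q`.
∣c∣≤∣↥c∣ : ∀ c → ℚ.∣ c ∣ ℚ.≤ fromℕ ℤ.∣ ℚ.↥ c ∣
∣c∣≤∣↥c∣ c@(mkℚ n d _) rewrite fromℕ≡mkℚ ℤ.∣ n ∣ =
  *≤* (ℤₚ.*-monoˡ-≤-nonNeg (+ ℤ.∣ n ∣) (ℤ.+≤+ (s≤s z≤n)))

∣c∣*↧c≡∣↥c∣ : ∀ c → ℚ.∣ c ∣ ℚ.* fromℕ (ℚ.↧ₙ c) ≡ fromℕ ℤ.∣ ℚ.↥ c ∣
∣c∣*↧c≡∣↥c∣ c@(mkℚ n d _) rewrite fromℕ≡mkℚ (suc d) =
  -- `mkℚᵘ` stores the denominator minus one, so `d * 1` encodes the denominator `suc d * 1` of the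
  -- product.
  ℚₚ.fromℚᵘ-cong {mkℚᵘ (+ ℤ.∣ n ∣ ℤ.* + suc d) (d * 1)} {mkℚᵘ (+ ℤ.∣ n ∣) 0}
    (*≡* (trans (ℤₚ.*-identityʳ _) (cong (λ k → + ℤ.∣ n ∣ ℤ.* + suc k) (sym (*-identityʳ d)))))

∣↥c∣≢0 : ∀ c → c ≢ 0ℚ → ℤ.∣ ℚ.↥ c ∣ ≢ 0
∣↥c∣≢0 c c≢0 eq = c≢0 (ℚₚ.↥p≡0⇒p≡0 c (ℤₚ.∣i∣≡0⇒i≡0 eq))

-- Coefficients of a polynomial times a series

-- A natural upper bound for the sum of the absolute values of the coefficients.
numeratorSum : Polynomial → ℕ
numeratorSum []      = 0
numeratorSum (c ∷ q) = ℤ.∣ ℚ.↥ c ∣ + numeratorSum q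

∣c*fromℕ∣≤ : ∀ c m → ℚ.∣ c ℚ.* fromℕ m ∣ ℚ.≤ fromℕ (ℤ.∣ ℚ.↥ c ∣ * m)
∣c*fromℕ∣≤ c m = begin
  ℚ.∣ c ℚ.* fromℕ m ∣                 ≡⟨ ℚₚ.∣p*q∣≡∣p∣*∣q∣ c (fromℕ m) ⟩
  ℚ.∣ c ∣ ℚ.* ℚ.∣ fromℕ m ∣           ≡⟨ cong (ℚ.∣ c ∣ ℚ.*_) (∣fromℕ∣ m) ⟩
  ℚ.∣ c ∣ ℚ.* fromℕ m
    ≤⟨ ℚₚ.*-monoʳ-≤-nonNeg (fromℕ m) {{ℚ.nonNegative (0≤fromℕ m)}} (∣c∣≤∣↥c∣ c) ⟩
  fromℕ ℤ.∣ ℚ.↥ c ∣ ℚ.* fromℕ m       ≡⟨ fromℕ-homo-* ℤ.∣ ℚ.↥ c ∣ m ⟨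
  fromℕ (ℤ.∣ ℚ.↥ c ∣ * m)             ∎
  where open ℚₚ.≤-Reasoning

[]⊛ : ∀ f n → (coeff [] ⊛ f) n ≡ 0ℚ
[]⊛ f zero    = trans (ℚₚ.+-identityʳ _) (ℚₚ.*-zeroˡ (f 0))
[]⊛ f (suc n) = trans (cong₂ ℚ._+_ (ℚₚ.*-zeroˡ (f (suc n))) ([]⊛ f n)) (ℚₚ.+-identityʳ 0ℚ)

-- Triangle inequality, peeling off the constant coefficient of `q`. The sum runs to `suc n` because
-- coefficient `n` of the product involves `f 0` up to `f n`.
∣⊛∣≤numeratorSum*partialSum : ∀ f q n →
  ℚ.∣ (coeff q ⊛ (fromℕ ∘ f)) n ∣ ℚ.≤ fromℕ (numeratorSum q * partialSum f (suc n))
∣⊛∣≤numeratorSum*partialSum f []      n       rewrite []⊛ (fromℕ ∘ f) n = ℚₚ.≤-refl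
∣⊛∣≤numeratorSum*partialSum f (c ∷ q) zero    = begin
  ℚ.∣ c ℚ.* fromℕ (f 0) ℚ.+ 0ℚ ∣     ≡⟨ cong ℚ.∣_∣ (ℚₚ.+-identityʳ (c ℚ.* fromℕ (f 0))) ⟩
  ℚ.∣ c ℚ.* fromℕ (f 0) ∣            ≤⟨ ∣c*fromℕ∣≤ c (f 0) ⟩
  fromℕ (ℤ.∣ ℚ.↥ c ∣ * f 0)          ≤⟨ fromℕ-mono-≤ (*-mono-≤ (m≤m+n ℤ.∣ ℚ.↥ c ∣ (numeratorSum q)) (m≤m+n (f 0) 0)) ⟩
  fromℕ (numeratorSum (c ∷ q) * partialSum f 1) ∎
  where open ℚₚ.≤-Reasoning
∣⊛∣≤numeratorSum*partialSum f (c ∷ q) (suc n) = begin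
  ℚ.∣ c ℚ.* fromℕ (f (suc n)) ℚ.+ (coeff q ⊛ (fromℕ ∘ f)) n ∣
    ≤⟨ ℚₚ.∣p+q∣≤∣p∣+∣q∣ (c ℚ.* fromℕ (f (suc n))) _ ⟩
  ℚ.∣ c ℚ.* fromℕ (f (suc n)) ∣ ℚ.+ ℚ.∣ (coeff q ⊛ (fromℕ ∘ f)) n ∣
    ≤⟨ ℚₚ.+-mono-≤ (∣c*fromℕ∣≤ c (f (suc n))) (∣⊛∣≤numeratorSum*partialSum f q n) ⟩
  fromℕ (m * f (suc n)) ℚ.+ fromℕ (numeratorSum q * S)
    ≡⟨ fromℕ-homo-+ (m * f (suc n)) (numeratorSum q * S) ⟨
  fromℕ (m * f (suc n) + numeratorSum q * S)
    ≤⟨ fromℕ-mono-≤ (+-mono-≤ (*-monoʳ-≤ m (m≤m+n (f (suc n)) S)) (*-monoʳ-≤ (numeratorSum q) (m≤n+m S (f (suc n))))) ⟩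
  fromℕ (m * (f (suc n) + S) + numeratorSum q * (f (suc n) + S))
    ≡⟨ cong fromℕ (*-distribʳ-+ (f (suc n) + S) m (numeratorSum q)) ⟨
  fromℕ (numeratorSum (c ∷ q) * partialSum f (suc (suc n))) ∎
  where
  open ℚₚ.≤-Reasoning
  m = ℤ.∣ ℚ.↥ c ∣
  S = partialSum f (suc n)

x+y≡0⇒∣x∣≡∣y∣ : ∀ x y → x ℚ.+ y ≡ 0ℚ → ℚ.∣ x ∣ ≡ ℚ.∣ y ∣
x+y≡0⇒∣x∣≡∣y∣ x y eq =
  trans (cong ℚ.∣_∣ (inverseˡ-unique ℚₚ.+-0-group x y eq)) (ℚₚ.∣-p∣≡∣p∣ y)

-- The vanishing coefficient is `c` times `f (suc n)` plus coefficient `n` of the product with `q`,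
-- so both have the same absolute value. Multiplying by the denominator of `c` moves the estimate to
-- ℕ.
leading-term-bound : ∀ f c q n → c ≢ 0ℚ → (coeff (c ∷ q) ⊛ (fromℕ ∘ f)) (suc n) ≡ 0ℚ →
                     f (suc n) ≤ ℚ.↧ₙ c * numeratorSum q * partialSum f (suc n)
leading-term-bound f c q n c≢0 eq = begin
  -- As `c` is nonzero, its numerator has absolute value at least 1.
  f (suc n)                     ≤⟨ m≤n*m (f (suc n)) m {{≢-nonZero (∣↥c∣≢0 c c≢0)}} ⟩
  m * f (suc n)                 ≤⟨ fromℕ-cancel-≤ scaled ⟩
  ℚ.↧ₙ c * (numeratorSum q * S)     ≡⟨ *-assoc (ℚ.↧ₙ c) (numeratorSum q) S ⟨
  ℚ.↧ₙ c * numeratorSum q * S       ∎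
  where
  open ≤-Reasoning
  m = ℤ.∣ ℚ.↥ c ∣
  S = partialSum f (suc n)
  den = fromℕ (ℚ.↧ₙ c)
  x = fromℕ (f (suc n))

  scaled : fromℕ (m * f (suc n)) ℚ.≤ fromℕ (ℚ.↧ₙ c * (numeratorSum q * S))
  scaled = ℚR.begin
    fromℕ (m * f (suc n))                   ℚR.≡⟨ fromℕ-homo-* m (f (suc n)) ⟩
    fromℕ m ℚ.* x                           ℚR.≡⟨ cong (ℚ._* x) (∣c∣*↧c≡∣↥c∣ c) ⟨
    (ℚ.∣ c ∣ ℚ.* den) ℚ.* x                 ℚR.≡⟨ cong (ℚ._* x) (ℚₚ.*-comm ℚ.∣ c ∣ den) ⟩
    (den ℚ.* ℚ.∣ c ∣) ℚ.* x                 ℚR.≡⟨ ℚₚ.*-assoc den ℚ.∣ c ∣ x ⟩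
    den ℚ.* (ℚ.∣ c ∣ ℚ.* x)                 ℚR.≡⟨ cong (λ y → den ℚ.* (ℚ.∣ c ∣ ℚ.* y)) (∣fromℕ∣ (f (suc n))) ⟨
    den ℚ.* (ℚ.∣ c ∣ ℚ.* ℚ.∣ x ∣)           ℚR.≡⟨ cong (den ℚ.*_) (ℚₚ.∣p*q∣≡∣p∣*∣q∣ c x) ⟨
    den ℚ.* ℚ.∣ c ℚ.* x ∣                   ℚR.≡⟨ cong (den ℚ.*_) (x+y≡0⇒∣x∣≡∣y∣ (c ℚ.* x) _ eq) ⟩
    den ℚ.* ℚ.∣ (coeff q ⊛ (fromℕ ∘ f)) n ∣
      ℚR.≤⟨ ℚₚ.*-monoˡ-≤-nonNeg den {{ℚ.nonNegative (0≤fromℕ (ℚ.↧ₙ c))}} (∣⊛∣≤numeratorSum*partialSum f q n) ⟩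
    den ℚ.* fromℕ (numeratorSum q * S)          ℚR.≡⟨ fromℕ-homo-* (ℚ.↧ₙ c) (numeratorSum q * S) ⟨
    fromℕ (ℚ.↧ₙ c * (numeratorSum q * S))       ℚR.∎
    where module ℚR = ℚₚ.≤-Reasoning

-- Induction on `q` strips zero constant terms until the lowest nonzero coefficient comes first.
bounded-by-partialSum : ∀ f N q → ¬ IsZero q →
  (∀ n → n ≥ N → (coeff q ⊛ (fromℕ ∘ f)) n ≡ 0ℚ) →
  ∃[ M ] ∃[ C ] ∀ n → f (M + n) ≤ C * partialSum f (M + n)
bounded-by-partialSum f N []      q≢0 _ = ⊥-elim (q≢0 (λ _ → refl))
bounded-by-partialSum f N (c ∷ q) q≢0 h with c ℚₚ.≟ 0ℚ
-- `leading-term-bound` speaks of successor indices only, hence the start at `suc N`.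
... | no c≢0   = suc N , ℚ.↧ₙ c * numeratorSum q , λ n →
  leading-term-bound f c q (N + n) c≢0 (h (suc (N + n)) (m≤n⇒m≤1+n (m≤m+n N n)))
... | yes refl = bounded-by-partialSum f N q
  (λ q≡0 → q≢0 λ { zero → refl ; (suc n) → q≡0 n })
  -- Dropping a zero constant term divides the polynomial by x, so coefficient `n` of the new
  -- product is coefficient `suc n` of the old one.
  λ n n≥N → begin
    (coeff q ⊛ (fromℕ ∘ f)) n                                 ≡⟨ ℚₚ.+-identityˡ _ ⟨
    0ℚ ℚ.+ (coeff q ⊛ (fromℕ ∘ f)) n
      ≡⟨ cong (ℚ._+ (coeff q ⊛ (fromℕ ∘ f)) n) (ℚₚ.*-zeroˡ (fromℕ (f (suc n)))) ⟨
    (coeff (0ℚ ∷ q) ⊛ (fromℕ ∘ f)) (suc n)                    ≡⟨ h (suc n) (m≤n⇒m≤1+n n≥N) ⟩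
    0ℚ                                                        ∎
  where open ≡-Reasoning

-- Irrationality of the generating function

coeff-≥length : ∀ p n → n ≥ length p → coeff p n ≡ 0ℚ
coeff-≥length []      n       _         = refl
coeff-≥length (c ∷ p) (suc n) (s≤s n≥p) = coeff-≥length p n n≥p

F-not-rational : ∀ p q → ¬ IsZero q → ¬ F IsQuotient p / q
F-not-rational p q q≢0 qF≡p
  with M , C , h ← bounded-by-partialSum a (length p) q q≢0
                     (λ n n≥p → trans (qF≡p n) (coeff-≥length p n n≥p)) =
  a-not-bounded-by-partialSum M C h

mainTheorem5 : (p q : Polynomial) → ¬ IsZero q → F IsQuotient p / q →
    (∃[ d ] HasDegree p d × d ≥ 500) ⊎ (∃[ d ] HasDegree q d × d ≥ 500)
-- The degree bound holds vacuously: no such quotient exists.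
mainTheorem5 p q q≢0 qF≡p = ⊥-elim (F-not-rational p q q≢0 qF≡p)
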